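{- For every positive integer $d$ there exists a monic polynomial $f_d(x)$ of degree $d$ with integer coefficients such that $\alpha_n^d=f_d(n)$ for all positive integers $n$ that are relatively prime to every nonzero determinant of a $d\times d$ matrix with entries in $\{0,1\}$.
   Context: For a positive integer $n$, $\mathbb{Z}_n$ is the ring of integers modulo $n$; a vector $(v_1,\dots,v_d)\in\mathbb{Z}_n^d$ is zero-sum-free if no non-empty subset of its components sums to $0$ in $\mathbb{Z}_n$; $\alpha_n^d$ is the number of such vectors. -}

module Defs where

open import Data.Bool using (Bool; true; false; if_then_else_)
open import Data.Nat using (ℕ; zero; suc; _+_; NonZero)
open import Data.Nat.DivMod using (_%_)
open import Data.Fin using (Fin; toℕ; punchIn)
import Data.Fin as F
open import Data.Fin.Subset using (Subset; Nonempty)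
open import Data.Fin.Subset.Properties using (anySubset?; nonempty?)
open import Data.Vec using (Vec; []; _∷_)
open import Data.Integer using (ℤ; +_; -_; _*_; _^_) renaming (_+_ to _+ℤ_)
open import Data.Product using (∃; _×_)
open import Relation.Binary.PropositionalEquality using (_≡_)
open import Relation.Nullary using (¬_; Dec; yes; no; ¬?; _×-dec_)
open import Relation.Nullary.Decidable using (⌊_⌋)
open import Data.Nat using (_≟_)

sumℕ : ∀ {k} → (Fin k → ℕ) → ℕ
sumℕ {zero}  f = 0
sumℕ {suc k} f = f F.zero + sumℕ (λ i → f (F.suc i))

sumℤ : ∀ {k} → (Fin k → ℤ) → ℤ
sumℤ {zero}  f = + 0
sumℤ {suc k} f = f F.zero +ℤ sumℤ (λ i → f (F.suc i))

-- ℤ_n^d is represented by Vec (Fin n) d (residues 0..n-1).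

subsetSum : ∀ {n d} → Vec (Fin n) d → Subset d → ℕ
subsetSum []       []       = 0
subsetSum (x ∷ xs) (b ∷ bs) = (if b then toℕ x else 0) + subsetSum xs bs

ZeroSumFree : ∀ {d} (n : ℕ) .{{_ : NonZero n}} → Vec (Fin n) d → Set
ZeroSumFree {d} n v = ¬ ∃ λ (S : Subset d) → Nonempty S × (subsetSum v S % n ≡ 0)

zeroSumFree? : ∀ {d} (n : ℕ) .{{_ : NonZero n}} (v : Vec (Fin n) d) → Dec (ZeroSumFree n v)
zeroSumFree? n v = ¬? (anySubset? (λ S → nonempty? S ×-dec (subsetSum v S % n ≟ 0)))

countVec : ∀ {n} (d : ℕ) → (Vec (Fin n) d → Bool) → ℕ
countVec zero    P = if P [] then 1 else 0
countVec (suc d) P = sumℕ (λ x → countVec d (λ xs → P (x ∷ xs)))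

α : (n : ℕ) .{{_ : NonZero n}} (d : ℕ) → ℕ
α n d = countVec d (λ v → ⌊ zeroSumFree? n v ⌋)

det : ∀ {k} → (Fin k → Fin k → ℤ) → ℤ
det {zero}  M = + 1
det {suc k} M =
  sumℤ (λ j → ((- + 1) ^ toℕ j) * (M F.zero j * det (λ r c → M (F.suc r) (punchIn j c))))

toℤMat : ∀ {k} → (Fin k → Fin k → Bool) → Fin k → Fin k → ℤ
toℤMat M i j = if M i j then + 1 else + 0

-- Monic integer polynomial of degree d: x^d + Σ_{i<d} c_i x^i,
-- determined by its lower coefficients c : Vec ℤ d.

evalMonic : ∀ {d} → Vec ℤ d → ℤ → ℤ
evalMonic {d} c x = (x ^ d) +ℤ sumℤ (λ i → Data.Vec.lookup c i * (x ^ toℕ i))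

{-# OPTIONS --safe #-}

-- Counting the vectors that avoid all hyperplanes S·v = 0 (S a non-empty subset) by
-- inclusion-exclusion, one subset at a time, reduces the theorem to counting the
-- solutions mod n of a homogeneous 0/1 system.  Such a system is carried along as a
-- nonsingular 0/1 matrix of size d, some of whose columns are marked as equations.
-- By Cramer's rule a new equation b is either a rational combination of the marked
-- columns, and then implied mod n because det M is a unit, or it can be exchanged for an
-- unmarked column while keeping the determinant nonzero.  As v ↦ Mᵀv permutes ℤ_n^d,
-- a system with r marked columns has n^(d - r) solutions.  The empty system alone
-- contributes to degree d, so the polynomial is monic.

module Submission where

open import Defs
open import Data.Nat as ℕ using (ℕ; zero; suc; NonZero; _≤_; _<_; z≤n; s≤s)
import Data.Nat.Properties as ℕ
import Data.Nat.Divisibility as ℕ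
open import Data.Nat.DivMod using (_%_)
open import Data.Nat.Coprimality using (Coprime; coprime-divisor)
open import Data.Fin using (Fin; zero; suc; toℕ; fromℕ<; punchIn; punchOut)
import Data.Fin.Properties as Fin
open import Data.Fin.Subset using (Subset; Nonempty)
open import Data.Fin.Subset.Properties using (nonempty?)
open import Data.Bool using (Bool; true; false; if_then_else_)
import Data.Bool.Properties as Bool
open import Data.Vec using (Vec; []; _∷_; lookup; tabulate)
open import Data.Vec.Properties
  using (≡-dec; ∷-injective; lookup∘tabulate; tabulate∘lookup; tabulate-cong; []=⇒lookup)
open import Data.List using (List; []; _∷_; _++_; map; filter)
open import Data.List.Membership.Propositional using (_∈_)
open import Data.List.Membership.Propositional.Properties using (∈-map⁺; ∈-++⁺ˡ; ∈-++⁺ʳ; ∈-filter⁺)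
open import Data.List.Relation.Unary.All as All using (All; []; _∷_)
open import Data.List.Relation.Unary.All.Properties using (all-filter)
open import Data.List.Relation.Unary.Any using (here)
open import Data.Integer using (ℤ; +_; ∣_∣; _+_; _*_; -_; _^_; 0ℤ; 1ℤ; _%ℕ_; _/ℕ_)
open import Data.Integer.Properties
open import Data.Integer.DivMod using (n%ℕd<d; a≡a%ℕn+[a/ℕn]*n)
open import Data.Integer.Divisibility.Signed
open import Data.Integer.Tactic.RingSolver using (solve-∀)
open import Data.Product using (∃; _,_; _×_; proj₁; proj₂)
open import Data.Sum using (_⊎_; inj₁; inj₂)
open import Function using (_∘_)
open import Relation.Nullary using (Dec; yes; no; ¬_; ¬?; _×-dec_; contradiction)
open import Relation.Nullary.Decidable using (⌊_⌋; _→-dec_)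
open import Relation.Unary using (Decidable)
open import Relation.Binary.PropositionalEquality
open import Algebra.Properties.CommutativeSemigroup ℕ.+-commutativeSemigroup using (interchange)
open import Algebra.Properties.CommutativeSemigroup +-commutativeSemigroup
  using () renaming (interchange to interchangeℤ)

-- Finite sums and counting

sumℕ-cong : ∀ {k} {f g : Fin k → ℕ} → (∀ i → f i ≡ g i) → sumℕ f ≡ sumℕ g
sumℕ-cong {zero}  eq = refl
sumℕ-cong {suc k} eq = cong₂ ℕ._+_ (eq zero) (sumℕ-cong (λ i → eq (suc i)))

sumℕ-const : ∀ k m → sumℕ {k} (λ _ → m) ≡ k ℕ.* m
sumℕ-const zero    m = refl
sumℕ-const (suc k) m = cong (m ℕ.+_) (sumℕ-const k m)

sumℕ-+ : ∀ {k} (f g : Fin k → ℕ) → sumℕ (λ i → f i ℕ.+ g i) ≡ sumℕ f ℕ.+ sumℕ g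
sumℕ-+ {zero}  f g = refl
sumℕ-+ {suc k} f g = trans
  (cong (f zero ℕ.+ g zero ℕ.+_) (sumℕ-+ (f ∘ suc) (g ∘ suc)))
  (interchange (f zero) (g zero) (sumℕ (f ∘ suc)) (sumℕ (g ∘ suc)))

sumℕ-mono : ∀ {k} {f g : Fin k → ℕ} → (∀ i → f i ≤ g i) → sumℕ f ≤ sumℕ g
sumℕ-mono {zero}  le = z≤n
sumℕ-mono {suc k} le = ℕ.+-mono-≤ (le zero) (sumℕ-mono (λ i → le (suc i)))

term≤sumℕ : ∀ {k} (f : Fin k → ℕ) i → f i ≤ sumℕ f
term≤sumℕ f zero    = ℕ.m≤m+n (f zero) _
term≤sumℕ f (suc i) = ℕ.≤-trans (term≤sumℕ (f ∘ suc) i) (ℕ.m≤n+m _ (f zero))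

sumℕ-unique : ∀ {k} (f : Fin k → ℕ) → (∀ i → f i ≤ 1) →
  (∀ i j → 0 < f i → 0 < f j → i ≡ j) → sumℕ f ≤ 1
sumℕ-unique {zero}  f ≤1 uniq = z≤n
sumℕ-unique {suc k} f ≤1 uniq with f zero in eq
... | zero  = sumℕ-unique (f ∘ suc) (≤1 ∘ suc)
                (λ i j p q → Fin.suc-injective (uniq (suc i) (suc j) p q))
... | suc m = subst (λ t → suc m ℕ.+ t ≤ 1) (sym rest≡0)
                (subst (_≤ 1) (sym (ℕ.+-identityʳ (suc m))) (subst (_≤ 1) eq (≤1 zero)))
  where
  0<f0 : 0 < f zero
  0<f0 = subst (0 <_) (sym eq) (s≤s z≤n)
  f∘suc≡0 : ∀ i → f (suc i) ≡ 0
  f∘suc≡0 i with f (suc i) in e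
  ... | zero  = refl
  ... | suc _ = contradiction (uniq zero (suc i) 0<f0 (subst (0 <_) (sym e) (s≤s z≤n))) λ ()
  rest≡0 : sumℕ (f ∘ suc) ≡ 0
  rest≡0 = trans (sumℕ-cong f∘suc≡0) (trans (sumℕ-const k 0) (ℕ.*-zeroʳ k))

0<sumℕ⇒∃ : ∀ {k} (f : Fin k → ℕ) → 0 < sumℕ f → ∃ λ i → 0 < f i
0<sumℕ⇒∃ {suc k} f 0<Σ with f zero in eq
... | suc m = zero , subst (0 <_) (sym eq) (s≤s z≤n)
... | zero  with 0<sumℕ⇒∃ (f ∘ suc) 0<Σ
...   | i , 0<fi = suc i , 0<fi

-- Sums over all vectors

sumVec : ∀ {n} d → (Vec (Fin n) d → ℕ) → ℕ
sumVec zero    f = f []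
sumVec (suc d) f = sumℕ (λ x → sumVec d (λ xs → f (x ∷ xs)))

module _ {n : ℕ} where

  sumVec-cong : ∀ d {f g : Vec (Fin n) d → ℕ} → (∀ v → f v ≡ g v) → sumVec d f ≡ sumVec d g
  sumVec-cong zero    eq = eq []
  sumVec-cong (suc d) eq = sumℕ-cong (λ x → sumVec-cong d (λ xs → eq (x ∷ xs)))

  sumVec-+ : ∀ d (f g : Vec (Fin n) d → ℕ) →
    sumVec d (λ v → f v ℕ.+ g v) ≡ sumVec d f ℕ.+ sumVec d g
  sumVec-+ zero    f g = refl
  sumVec-+ (suc d) f g = trans
    (sumℕ-cong (λ x → sumVec-+ d (λ xs → f (x ∷ xs)) (λ xs → g (x ∷ xs))))
    (sumℕ-+ (λ x → sumVec d (λ xs → f (x ∷ xs))) (λ x → sumVec d (λ xs → g (x ∷ xs))))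

  sumVec-zero : ∀ d → sumVec d (λ (_ : Vec (Fin n) d) → 0) ≡ 0
  sumVec-zero zero    = refl
  sumVec-zero (suc d) = trans (sumℕ-cong {n} (λ _ → sumVec-zero d))
    (trans (sumℕ-const n 0) (ℕ.*-zeroʳ n))

  sumVec-mono : ∀ d {f g : Vec (Fin n) d → ℕ} → (∀ v → f v ≤ g v) → sumVec d f ≤ sumVec d g
  sumVec-mono zero    le = le []
  sumVec-mono (suc d) le = sumℕ-mono (λ x → sumVec-mono d (λ xs → le (x ∷ xs)))

  term≤sumVec : ∀ d (f : Vec (Fin n) d → ℕ) v → f v ≤ sumVec d f
  term≤sumVec zero    f []       = ℕ.≤-refl
  term≤sumVec (suc d) f (x ∷ xs) = ℕ.≤-trans
    (term≤sumVec d (λ ys → f (x ∷ ys)) xs)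
    (term≤sumℕ (λ y → sumVec d (λ ys → f (y ∷ ys))) x)

  0<sumVec⇒∃ : ∀ d (f : Vec (Fin n) d → ℕ) → 0 < sumVec d f → ∃ λ v → 0 < f v
  0<sumVec⇒∃ zero    f 0<Σ = [] , 0<Σ
  0<sumVec⇒∃ (suc d) f 0<Σ with 0<sumℕ⇒∃ (λ x → sumVec d (λ xs → f (x ∷ xs))) 0<Σ
  ... | x , 0<Σx with 0<sumVec⇒∃ d (λ xs → f (x ∷ xs)) 0<Σx
  ...   | xs , 0<f = x ∷ xs , 0<f

  -- Meant for the indicator of a fibre of an injective map, which is supported on at most one
  -- vector.
  sumVec-unique : ∀ d (f : Vec (Fin n) d → ℕ) → (∀ v → f v ≤ 1) →
    (∀ v w → 0 < f v → 0 < f w → v ≡ w) → sumVec d f ≤ 1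
  sumVec-unique zero    f ≤1 uniq = ≤1 []
  sumVec-unique (suc d) f ≤1 uniq = sumℕ-unique (λ x → sumVec d (λ xs → f (x ∷ xs)))
    (λ x → sumVec-unique d (λ xs → f (x ∷ xs)) (λ xs → ≤1 (x ∷ xs))
      (λ v w p q → proj₂ (∷-injective (uniq (x ∷ v) (x ∷ w) p q))))
    (λ x y p q →
      let v , 0<fv = 0<sumVec⇒∃ d (λ xs → f (x ∷ xs)) p
          w , 0<fw = 0<sumVec⇒∃ d (λ xs → f (y ∷ xs)) q
      in proj₁ (∷-injective (uniq (x ∷ v) (y ∷ w) 0<fv 0<fw)))

  sumVec-sumℕ-swap : ∀ d {k} (f : Vec (Fin n) d → Fin k → ℕ) →
    sumVec d (λ v → sumℕ (f v)) ≡ sumℕ (λ i → sumVec d (λ v → f v i))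
  sumVec-sumℕ-swap d {zero}  f = sumVec-zero d
  sumVec-sumℕ-swap d {suc k} f = trans
    (sumVec-+ d (λ v → f v zero) (λ v → sumℕ (f v ∘ suc)))
    (cong (sumVec d (λ v → f v zero) ℕ.+_) (sumVec-sumℕ-swap d (λ v → f v ∘ suc)))

  sumVec-swap : ∀ d e (f : Vec (Fin n) d → Vec (Fin n) e → ℕ) →
    sumVec d (λ v → sumVec e (f v)) ≡ sumVec e (λ w → sumVec d (λ v → f v w))
  sumVec-swap d zero    f = refl
  sumVec-swap d (suc e) f = trans
    (sumVec-sumℕ-swap d (λ v x → sumVec e (λ xs → f v (x ∷ xs))))
    (sumℕ-cong (λ x → sumVec-swap d e (λ v xs → f v (x ∷ xs))))

-- Indicators and counting

indicator : ∀ {A : Set} → Dec A → ℕ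
indicator a? = if ⌊ a? ⌋ then 1 else 0

indicator-yes : ∀ {A : Set} (a? : Dec A) → A → indicator a? ≡ 1
indicator-yes (yes _) a = refl
indicator-yes (no ¬a) a = contradiction a ¬a

indicator-no : ∀ {A : Set} (a? : Dec A) → ¬ A → indicator a? ≡ 0
indicator-no (yes a) ¬a = contradiction a ¬a
indicator-no (no _)  ¬a = refl

indicator≤1 : ∀ {A : Set} (a? : Dec A) → indicator a? ≤ 1
indicator≤1 (yes _) = ℕ.≤-refl
indicator≤1 (no _)  = z≤n

0<indicator⇒ : ∀ {A : Set} (a? : Dec A) → 0 < indicator a? → A
0<indicator⇒ (yes a) _ = a

indicator-cong : ∀ {A B : Set} (a? : Dec A) (b? : Dec B) → (A → B) → (B → A) →
  indicator a? ≡ indicator b?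
indicator-cong (yes a) b? f g = sym (indicator-yes b? (f a))
indicator-cong (no ¬a) b? f g = sym (indicator-no b? (¬a ∘ g))

indicator-¬ : ∀ {A : Set} (a? : Dec A) → 1 ≡ indicator a? ℕ.+ indicator (¬? a?)
indicator-¬ (yes _) = refl
indicator-¬ (no _)  = refl

indicator-split : ∀ {A B : Set} (a? : Dec A) (b? : Dec B) →
  indicator a? ≡ indicator (a? ×-dec b?) ℕ.+ indicator (a? ×-dec ¬? b?)
indicator-split (yes _) (yes _) = refl
indicator-split (yes _) (no _)  = refl
indicator-split (no _)  (yes _) = refl
indicator-split (no _)  (no _)  = refl

count : ∀ {n d} {P : Vec (Fin n) d → Set} → Decidable P → ℕ
count {d = d} P? = sumVec d (λ v → indicator (P? v))

countVec≡sumVec : ∀ {n} d (P : Vec (Fin n) d → Bool) →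
  countVec d P ≡ sumVec d (λ v → if P v then 1 else 0)
countVec≡sumVec zero    P = refl
countVec≡sumVec (suc d) P = sumℕ-cong (λ x → countVec≡sumVec d (λ xs → P (x ∷ xs)))

module _ {n d : ℕ} where

  private
    V = Vec (Fin n) d
    _≟ᵛ_ = ≡-dec {n = d} (Fin._≟_ {n})

  count-cong : {P Q : V → Set} (P? : Decidable P) (Q? : Decidable Q) →
    (∀ v → P v → Q v) → (∀ v → Q v → P v) → count P? ≡ count Q?
  count-cong P? Q? f g = sumVec-cong d (λ v → indicator-cong (P? v) (Q? v) (f v) (g v))

  count-none : {P : V → Set} (P? : Decidable P) → (∀ v → ¬ P v) → count P? ≡ 0
  count-none P? ¬P = trans (sumVec-cong d (λ v → indicator-no (P? v) (¬P v))) (sumVec-zero d)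

  count-split : {P Q : V → Set} (P? : Decidable P) (Q? : Decidable Q) →
    count P? ≡ count (λ v → P? v ×-dec Q? v) ℕ.+ count (λ v → P? v ×-dec ¬? (Q? v))
  count-split P? Q? = trans
    (sumVec-cong d (λ v → indicator-split (P? v) (Q? v)))
    (sumVec-+ d (λ v → indicator (P? v ×-dec Q? v)) (λ v → indicator (P? v ×-dec ¬? (Q? v))))

  count-¬ : {P : V → Set} (P? : Decidable P) →
    sumVec d (λ (_ : V) → 1) ≡ count P? ℕ.+ count (¬? ∘ P?)
  count-¬ P? = trans
    (sumVec-cong d (λ v → indicator-¬ (P? v)))
    (sumVec-+ d (indicator ∘ P?) (indicator ∘ ¬? ∘ P?))

  module _ (φ : V → V) (φ-injective : ∀ v w → φ v ≡ φ w → v ≡ w) where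

    -- Double counting of the pairs (v , w) with φ v ≡ w and P w.
    count-∘-≤ : {P : V → Set} (P? : Decidable P) → count (P? ∘ φ) ≤ count P?
    count-∘-≤ {P} P? = begin
      sumVec d (λ v → indicator (P? (φ v)))       ≤⟨ sumVec-mono d image ⟩
      sumVec d (λ v → sumVec d (λ w → pair v w))  ≡⟨ sumVec-swap d d pair ⟩
      sumVec d (λ w → sumVec d (λ v → pair v w))  ≤⟨ sumVec-mono d fibre ⟩
      sumVec d (λ w → indicator (P? w))           ∎
      where
      open ℕ.≤-Reasoning
      pair : V → V → ℕ
      pair v w = indicator (φ v ≟ᵛ w ×-dec P? w)
      image : ∀ v → indicator (P? (φ v)) ≤ sumVec d (pair v)
      image v = ℕ.≤-trans
        (ℕ.≤-reflexive (indicator-cong (P? (φ v)) (φ v ≟ᵛ φ v ×-dec P? (φ v)) (refl ,_) proj₂))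
        (term≤sumVec d (pair v) (φ v))
      fibre : ∀ w → sumVec d (λ v → pair v w) ≤ indicator (P? w)
      fibre w with P? w
      ... | yes p = sumVec-unique d _ (λ v → indicator≤1 (φ v ≟ᵛ w ×-dec yes p))
              (λ u v p q → φ-injective u v (trans
                (proj₁ (0<indicator⇒ (φ u ≟ᵛ w ×-dec _) p))
                (sym (proj₁ (0<indicator⇒ (φ v ≟ᵛ w ×-dec _) q)))))
      ... | no ¬p = ℕ.≤-reflexive (trans
              (sumVec-cong d (λ v → indicator-no (φ v ≟ᵛ w ×-dec no ¬p) (¬p ∘ proj₂)))
              (sumVec-zero d))

    -- The inequality holds for `P` and for its complement, and on both sides the two counts add up
    -- to the number of all vectors. Hence neither inequality can be strict, and no inverse of `φ`
    -- has to be constructed.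
    count-∘-injective : {P : V → Set} (P? : Decidable P) → count (P? ∘ φ) ≡ count P?
    count-∘-injective P? = ℕ.≤-antisym (count-∘-≤ P?) (ℕ.+-cancelʳ-≤ (count (¬? ∘ P?)) _ _ (begin
      count P? ℕ.+ count (¬? ∘ P?)             ≡⟨ count-¬ P? ⟨
      sumVec d (λ _ → 1)                       ≡⟨ count-¬ (P? ∘ φ) ⟩
      count (P? ∘ φ) ℕ.+ count (¬? ∘ P? ∘ φ)   ≤⟨ ℕ.+-monoʳ-≤ (count (P? ∘ φ)) (count-∘-≤ (¬? ∘ P?)) ⟩
      count (P? ∘ φ) ℕ.+ count (¬? ∘ P?)       ∎))
      where open ℕ.≤-Reasoning

-- Vectors with prescribed zero coordinates

unused : ∀ {d} → (Fin d → Bool) → ℕ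
unused {zero}  used = 0
unused {suc d} used = (if used zero then 0 else 1) ℕ.+ unused (λ j → used (suc j))

unused≤ : ∀ {d} (used : Fin d → Bool) → unused used ≤ d
unused≤ {zero}  used = z≤n
unused≤ {suc d} used with used zero
... | true  = ℕ.m≤n⇒m≤1+n (unused≤ (used ∘ suc))
... | false = s≤s (unused≤ (used ∘ suc))

unused< : ∀ {d} (used : Fin d → Bool) j → used j ≡ true → unused used < d
unused< used zero    eq rewrite eq = s≤s (unused≤ (used ∘ suc))
unused< used (suc j) eq with used zero
... | true  = ℕ.m≤n⇒m≤1+n (unused< (used ∘ suc) j eq)
... | false = s≤s (unused< (used ∘ suc) j eq)

unused≡ : ∀ {d} (used : Fin d → Bool) → (∀ j → used j ≡ false) → unused used ≡ d
unused≡ {zero}  used eq = refl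
unused≡ {suc d} used eq rewrite eq zero = cong suc (unused≡ (used ∘ suc) (eq ∘ suc))

ZeroOn : ∀ {n d} → (Fin d → Bool) → Vec (Fin n) d → Set
ZeroOn used w = ∀ j → used j ≡ true → toℕ (lookup w j) ≡ 0

zeroOn? : ∀ {n d} (used : Fin d → Bool) → Decidable (ZeroOn {n} used)
zeroOn? used w = Fin.all? (λ j → (used j Bool.≟ true) →-dec (toℕ (lookup w j) ℕ.≟ 0))

-- A free first coordinate contributes a factor `n`, a marked one admits only the residue 0. The
-- mark is passed as a separate Boolean `b` with an equation so that it can be matched on.
count-zeroOn-suc : ∀ {n} .{{_ : NonZero n}} {d} (used : Fin (suc d) → Bool) b → used zero ≡ b →
  count (zeroOn? {n} used) ≡ n ℕ.^ (if b then 0 else 1) ℕ.* count (zeroOn? {n} (used ∘ suc))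
count-zeroOn-suc {n} used false eq = trans
  (sumℕ-cong {n} (λ x → count-cong (λ xs → zeroOn? used (x ∷ xs)) (zeroOn? (used ∘ suc))
    (λ xs z j → z (suc j))
    (λ { xs z zero used₀ → contradiction (trans (sym eq) used₀) (λ ()) ; xs z (suc j) → z j })))
  (trans (sumℕ-const n (count (zeroOn? {n} (used ∘ suc))))
    (cong (ℕ._* count (zeroOn? {n} (used ∘ suc))) (sym (ℕ.*-identityʳ n))))
-- The right-hand side computes to `count ... + 0`: the first summand is the residue `zero`, and the
-- nonzero residues together give 0.
count-zeroOn-suc {suc n} used true eq = cong₂ ℕ._+_
  (count-cong (λ xs → zeroOn? used (zero ∷ xs)) (zeroOn? (used ∘ suc))
    (λ xs z j → z (suc j))
    (λ { xs z zero _ → refl ; xs z (suc j) → z j }))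
  (trans
    (sumℕ-cong {n} (λ x → count-none (λ xs → zeroOn? used (suc x ∷ xs))
      (λ xs z → contradiction (z zero eq) (λ ()))))
    (trans (sumℕ-const n 0) (ℕ.*-zeroʳ n)))

count-zeroOn : ∀ {n} .{{_ : NonZero n}} {d} (used : Fin d → Bool) →
  count (zeroOn? {n} used) ≡ n ℕ.^ unused used
count-zeroOn {n} {zero}  used = indicator-yes (zeroOn? {n} used []) (λ ())
count-zeroOn {n} {suc d} used = trans
  (count-zeroOn-suc used (used zero) refl)
  (trans
    (cong (n ℕ.^ (if used zero then 0 else 1) ℕ.*_) (count-zeroOn (used ∘ suc)))
    (sym (ℕ.^-distribˡ-+-* n (if used zero then 0 else 1) (unused (used ∘ suc)))))

-- Determinants

open ≡-Reasoning

sumℤ-cong : ∀ {k} {f g : Fin k → ℤ} → (∀ i → f i ≡ g i) → sumℤ f ≡ sumℤ g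
sumℤ-cong {zero}  eq = refl
sumℤ-cong {suc k} eq = cong₂ _+_ (eq zero) (sumℤ-cong (λ i → eq (suc i)))

sumℤ-zero : ∀ {k} (f : Fin k → ℤ) → (∀ i → f i ≡ 0ℤ) → sumℤ f ≡ 0ℤ
sumℤ-zero {zero}  f eq = refl
sumℤ-zero {suc k} f eq = cong₂ _+_ (eq zero) (sumℤ-zero (λ i → f (suc i)) (λ i → eq (suc i)))

sumℤ-+ : ∀ {k} (f g : Fin k → ℤ) → sumℤ (λ i → f i + g i) ≡ sumℤ f + sumℤ g
sumℤ-+ {zero}  f g = refl
sumℤ-+ {suc k} f g = trans
  (cong (λ t → f zero + g zero + t) (sumℤ-+ (λ i → f (suc i)) (λ i → g (suc i))))
  (interchangeℤ (f zero) (g zero) (sumℤ (λ i → f (suc i))) (sumℤ (λ i → g (suc i))))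

sumℤ-*ˡ : ∀ {k} a (f : Fin k → ℤ) → sumℤ (λ i → a * f i) ≡ a * sumℤ f
sumℤ-*ˡ {zero}  a f = sym (*-zeroʳ a)
sumℤ-*ˡ {suc k} a f = trans
  (cong (λ t → a * f zero + t) (sumℤ-*ˡ a (λ i → f (suc i))))
  (sym (*-distribˡ-+ a (f zero) (sumℤ (λ i → f (suc i)))))

sumℤ-swap : ∀ {k l} (f : Fin k → Fin l → ℤ) →
  sumℤ (λ i → sumℤ (λ j → f i j)) ≡ sumℤ (λ j → sumℤ (λ i → f i j))
sumℤ-swap {zero}  f = sym (sumℤ-zero (λ j → sumℤ (λ i → f i j)) (λ j → refl))
sumℤ-swap {suc k} f = trans
  (cong (λ t → sumℤ (f zero) + t) (sumℤ-swap (λ i → f (suc i))))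
  (sym (sumℤ-+ (f zero) (λ j → sumℤ (λ i → f (suc i) j))))

-- The sign pattern of a Laplace expansion: `det` of a nonempty matrix unfolds definitionally to an
-- `altSum` over the columns.
altSum : ∀ {k} → (Fin k → ℤ) → ℤ
altSum f = sumℤ (λ j → (- + 1) ^ toℕ j * f j)

altSum-cong : ∀ {k} {f g : Fin k → ℤ} → (∀ i → f i ≡ g i) → altSum f ≡ altSum g
altSum-cong eq = sumℤ-cong (λ j → cong ((- + 1) ^ toℕ j *_) (eq j))

altSum-+ : ∀ {k} (f g : Fin k → ℤ) → altSum (λ j → f j + g j) ≡ altSum f + altSum g
altSum-+ f g = trans
  (sumℤ-cong (λ j → *-distribˡ-+ ((- + 1) ^ toℕ j) (f j) (g j)))
  (sumℤ-+ (λ j → (- + 1) ^ toℕ j * f j) (λ j → (- + 1) ^ toℕ j * g j))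

altSum-*ˡ : ∀ {k} a (f : Fin k → ℤ) → altSum (λ j → a * f j) ≡ a * altSum f
altSum-*ˡ a f = trans
  (sumℤ-cong (λ j → comm ((- + 1) ^ toℕ j) a (f j)))
  (sumℤ-*ˡ a (λ j → (- + 1) ^ toℕ j * f j))
  where
  comm : ∀ s a x → s * (a * x) ≡ a * (s * x)
  comm = solve-∀

altSum-suc : ∀ {k} (f : Fin (suc k) → ℤ) →
  altSum f ≡ f zero + (- + 1) * altSum (λ j → f (suc j))
altSum-suc f = cong₂ _+_ (*-identityˡ (f zero)) (trans
  (sumℤ-cong (λ j → *-assoc (- + 1) ((- + 1) ^ toℕ j) (f (suc j))))
  (sumℤ-*ˡ (- + 1) (λ j → (- + 1) ^ toℕ j * f (suc j))))

-- Laplace expansion along two rows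

Extensional : ∀ {k l} → ((Fin k → Fin l) → ℤ) → Set
Extensional Φ = ∀ f g → (∀ x → f x ≡ g x) → Φ f ≡ Φ g

-- The rows `u` and `w` are expanded in turn, and `Φ f` stands for the minor of the remaining rows
-- on the columns selected by `f`. With `Φ` abstract, antisymmetry can be proved by induction on the
-- number of columns alone.
expand₂ : ∀ {k} → (u w : Fin (suc (suc k)) → ℤ) → ((Fin k → Fin (suc (suc k))) → ℤ) → ℤ
expand₂ u w Φ = altSum (λ j → u j * altSum (λ c →
  w (punchIn j c) * Φ (λ x → punchIn j (punchIn c x))))

tail : ∀ {A : Set} {k} → (Fin (suc k) → A) → Fin k → A
tail u i = u (suc i)

lift : ∀ {k l} → (Fin k → Fin l) → Fin (suc k) → Fin (suc l)
lift f zero    = zero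
lift f (suc x) = suc (f x)

expand₂-rest : ∀ {k} → (u w : Fin (suc (suc k)) → ℤ) → ((Fin k → Fin (suc (suc k))) → ℤ) → ℤ
expand₂-rest u w Φ = altSum (λ j → u (suc j) * altSum (λ c →
  w (suc (punchIn j c)) * Φ (λ x → punchIn (suc j) (punchIn (suc c) x))))

expand₂-border : ∀ {k} → (u w : Fin (suc (suc k)) → ℤ) → ((Fin k → Fin (suc (suc k))) → ℤ) → ℤ
expand₂-border u w Φ = u zero * altSum (λ c → w (suc c) * Φ (λ x → suc (punchIn c x)))

-- The pairs (0 , c) and (suc j , 0) of deleted columns leave the same minors, with
-- opposite signs; expand₂-rest collects the pairs avoiding column 0.
expand₂-split : ∀ {k} u w (Φ : (Fin k → Fin (suc (suc k))) → ℤ) →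
  expand₂ u w Φ ≡ expand₂-border u w Φ + - expand₂-border w u Φ + expand₂-rest u w Φ
expand₂-split u w Φ = begin
  expand₂ u w Φ
    ≡⟨ altSum-suc (λ j → u j * altSum (λ c → w (punchIn j c) * Φ (λ x → punchIn j (punchIn c x)))) ⟩
  X + (- + 1) * altSum (λ j → u (suc j) * altSum (λ c →
        w (punchIn (suc j) c) * Φ (λ x → punchIn (suc j) (punchIn c x))))
    ≡⟨ cong (λ t → X + (- + 1) * t) (begin
         altSum (λ j → u (suc j) * altSum (λ c →
           w (punchIn (suc j) c) * Φ (λ x → punchIn (suc j) (punchIn c x))))
           ≡⟨ altSum-cong (λ j → trans
                (cong (u (suc j) *_) (altSum-suc (λ c →
                  w (punchIn (suc j) c) * Φ (λ x → punchIn (suc j) (punchIn c x)))))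
                (expandTerm (u (suc j)) (w zero) (Φ (λ x → suc (punchIn j x))) (inner j))) ⟩
         altSum (λ j → w zero * (u (suc j) * Φ (λ x → suc (punchIn j x)))
                       + (- + 1) * (u (suc j) * inner j))
           ≡⟨ altSum-+ (λ j → w zero * (u (suc j) * Φ (λ x → suc (punchIn j x))))
                       (λ j → (- + 1) * (u (suc j) * inner j)) ⟩
         altSum (λ j → w zero * (u (suc j) * Φ (λ x → suc (punchIn j x))))
           + altSum (λ j → (- + 1) * (u (suc j) * inner j))
           ≡⟨ cong₂ _+_ (altSum-*ˡ (w zero) (λ j → u (suc j) * Φ (λ x → suc (punchIn j x))))
                        (altSum-*ˡ (- + 1) (λ j → u (suc j) * inner j)) ⟩
         Y + (- + 1) * R ∎) ⟩
  X + (- + 1) * (Y + (- + 1) * R)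
    ≡⟨ signs X Y R ⟩
  X + - Y + R ∎
  where
  X = expand₂-border u w Φ
  Y = expand₂-border w u Φ
  R = expand₂-rest u w Φ
  inner : Fin _ → ℤ
  inner j = altSum (λ c → w (suc (punchIn j c)) * Φ (λ x → punchIn (suc j) (punchIn (suc c) x)))
  expandTerm : ∀ a b p r → a * (b * p + (- + 1) * r) ≡ b * (a * p) + (- + 1) * (a * r)
  expandTerm = solve-∀
  signs : ∀ x y r → x + (- + 1) * (y + (- + 1) * r) ≡ x + - y + r
  signs = solve-∀

-- When column 0 is not deleted it stays the first selected column, so the selection is a `lift` of
-- one among the remaining columns. The two selections agree only pointwise, which is where
-- `Extensional` enters.
expand₂-rest-suc : ∀ {k} u w (Φ : (Fin (suc k) → Fin (suc (suc (suc k)))) → ℤ) → Extensional Φ →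
  expand₂-rest u w Φ ≡ expand₂ (tail u) (tail w) (λ f → Φ (lift f))
expand₂-rest-suc u w Φ ext = altSum-cong (λ j → cong (u (suc j) *_) (altSum-cong (λ c →
  cong (w (suc (punchIn j c)) *_) (ext
    (λ x → punchIn (suc j) (punchIn (suc c) x))
    (lift (λ x → punchIn j (punchIn c x)))
    λ { zero → refl ; (suc x) → refl }))))

lift-cong : ∀ {k l} {f g : Fin k → Fin l} → (∀ x → f x ≡ g x) → ∀ x → lift f x ≡ lift g x
lift-cong eq zero    = refl
lift-cong eq (suc x) = cong suc (eq x)

-- Exchanging `u` and `w` exchanges the two border terms, which carry opposite signs. The rest is a
-- two-row expansion with one column fewer, handled by mutual induction.
expand₂-antisym : ∀ {k} u w (Φ : (Fin k → Fin (suc (suc k))) → ℤ) → Extensional Φ →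
  expand₂ u w Φ ≡ - expand₂ w u Φ
expand₂-rest-antisym : ∀ {k} u w (Φ : (Fin k → Fin (suc (suc k))) → ℤ) → Extensional Φ →
  expand₂-rest u w Φ ≡ - expand₂-rest w u Φ

expand₂-antisym u w Φ ext = begin
  expand₂ u w Φ                          ≡⟨ expand₂-split u w Φ ⟩
  X + - Y + expand₂-rest u w Φ           ≡⟨ cong (λ t → X + - Y + t) (expand₂-rest-antisym u w Φ ext) ⟩
  X + - Y + - expand₂-rest w u Φ         ≡⟨ signs X Y (expand₂-rest w u Φ) ⟩
  - (Y + - X + expand₂-rest w u Φ)       ≡⟨ cong -_ (expand₂-split w u Φ) ⟨
  - expand₂ w u Φ                        ∎
  where
  X = expand₂-border u w Φ
  Y = expand₂-border w u Φ
  signs : ∀ x y r → x + - y + - r ≡ - (y + - x + r)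
  signs = solve-∀

-- With two columns in all, no pair of distinct columns avoids column 0, so the inner sum is empty.
expand₂-rest-antisym {zero} u w Φ ext = trans (vanish u w) (cong -_ (sym (vanish w u)))
  where
  vanish : ∀ u w → expand₂-rest u w Φ ≡ 0ℤ
  vanish u w = cong (λ t → 1ℤ * t + 0ℤ) (*-zeroʳ (u (suc zero)))
expand₂-rest-antisym {suc k} u w Φ ext = begin
  expand₂-rest u w Φ                               ≡⟨ expand₂-rest-suc u w Φ ext ⟩
  expand₂ (tail u) (tail w) (λ f → Φ (lift f))
    ≡⟨ expand₂-antisym (tail u) (tail w) (λ f → Φ (lift f))
         (λ f g eq → ext (lift f) (lift g) (lift-cong eq)) ⟩
  - expand₂ (tail w) (tail u) (λ f → Φ (lift f))   ≡⟨ cong -_ (expand₂-rest-suc w u Φ ext) ⟨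
  - expand₂-rest w u Φ                             ∎

Matrix : ℕ → Set
Matrix k = Fin k → Fin k → ℤ

det-cong : ∀ {k} {M N : Matrix k} → (∀ i j → M i j ≡ N i j) → det M ≡ det N
det-cong {zero}  eq = refl
det-cong {suc k} eq = altSum-cong (λ j →
  cong₂ _*_ (eq zero j) (det-cong (λ r c → eq (suc r) (punchIn j c))))

swap₀₁ : ∀ {k} → Fin (suc (suc k)) → Fin (suc (suc k))
swap₀₁ zero          = suc zero
swap₀₁ (suc zero)    = zero
swap₀₁ (suc (suc i)) = suc (suc i)

-- Two unfoldings of `det` are definitionally `expand₂` of the top two rows, with `Φ` the
-- determinant of the lower rows on the selected columns.
det-swap₀₁ : ∀ {k} (M : Matrix (suc (suc k))) → det M ≡ - det (λ i → M (swap₀₁ i))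
det-swap₀₁ M = expand₂-antisym (M zero) (M (suc zero))
  (λ f → det (λ r x → M (suc (suc r)) (f x)))
  (λ f g eq → det-cong (λ r x → cong (M (suc (suc r))) (eq x)))

i≡-i⇒i≡0 : ∀ i → i ≡ - i → i ≡ 0ℤ
i≡-i⇒i≡0 (+ zero) _ = refl

-- If the top two rows agree, swapping them fixes `M`, so the determinant equals its own negative.
-- Otherwise the swap moves row 0 to the top of every minor in the first-row expansion, where its
-- copy also occurs, and each minor vanishes by induction.
det-repeatedRow : ∀ {k} (M : Matrix (suc k)) (i : Fin k) →
  (∀ j → M zero j ≡ M (suc i) j) → det M ≡ 0ℤ
det-repeatedRow M zero eq = i≡-i⇒i≡0 (det M) (trans (det-swap₀₁ M)
  (cong -_ (det-cong {M = λ i → M (swap₀₁ i)} {N = M}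
    λ { zero j → sym (eq j) ; (suc zero) j → eq j ; (suc (suc r)) j → refl })))
det-repeatedRow M (suc i) eq = trans (det-swap₀₁ M) (cong -_ (sumℤ-zero _ (λ j → trans
  (cong (λ t → (- + 1) ^ toℕ j * (M (suc zero) j * t))
    (det-repeatedRow (λ r c → M (swap₀₁ (suc r)) (punchIn j c)) i (λ c → eq (punchIn j c))))
  (trans (cong ((- + 1) ^ toℕ j *_) (*-zeroʳ (M (suc zero) j))) (*-zeroʳ ((- + 1) ^ toℕ j))))))

-- The entry type is arbitrary so that minors of a 0/1 array are again 0/1 arrays, to which the
-- coprimality hypothesis can apply.
minor : ∀ {A : Set} {k} → (Fin k → Fin (suc k) → A) → Fin (suc k) → Fin k → Fin k → A
minor N j r c = N r (punchIn j c)

-- Placing a second copy of row `i` on top of `N` gives a square matrix with a repeated row; the sum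
-- is its Laplace expansion along that top row.
plücker : ∀ {k} (N : Fin k → Fin (suc k) → ℤ) (i : Fin k) →
  altSum (λ j → N i j * det (minor N j)) ≡ 0ℤ
plücker {k} N i = det-repeatedRow N⁺ i (λ j → refl)
  where
  N⁺ : Matrix (suc k)
  N⁺ zero    = N i
  N⁺ (suc r) = N r

identity : ∀ {k} → Fin k → Fin k → Bool
identity zero    zero    = true
identity (suc i) (suc j) = identity i j
identity _       _       = false

det-identity : ∀ k → det (toℤMat (identity {k})) ≡ 1ℤ
det-identity zero    = refl
det-identity (suc k) = cong₂ _+_
  (trans (*-identityˡ (1ℤ * det (toℤMat (identity {k}))))
    (trans (*-identityˡ (det (toℤMat (identity {k})))) (det-identity k)))
  (sumℤ-zero {k} _ (λ j → *-zeroʳ ((- + 1) ^ toℕ (suc j))))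

-- 0/1 linear forms modulo n

toℤ : Bool → ℤ
toℤ b = if b then + 1 else + 0

dot : ∀ {d} → (Fin d → ℤ) → (Fin d → Bool) → ℤ
dot x c = sumℤ (λ i → x i * toℤ (c i))

dot-identity : ∀ {d} (x : Fin d → ℤ) i → dot x (identity i) ≡ x i
dot-identity {suc d} x zero = trans
  (cong₂ _+_ (*-identityʳ (x zero)) (sumℤ-zero {d} _ (λ i → *-zeroʳ (x (suc i)))))
  (+-identityʳ (x zero))
dot-identity x (suc i) = trans
  (cong₂ _+_ (*-zeroʳ (x zero)) (dot-identity (x ∘ suc) i))
  (+-identityˡ (x (suc i)))

dot-minus : ∀ {d} (x y : Fin d → ℤ) c → dot (λ i → x i + - y i) c ≡ dot x c + - dot y c
dot-minus {zero}  x y c = refl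
dot-minus {suc d} x y c = trans
  (cong (λ t → (x zero + - y zero) * toℤ (c zero) + t) (dot-minus (x ∘ suc) (y ∘ suc) (c ∘ suc)))
  (rearrange (x zero) (y zero) (toℤ (c zero)) (dot (x ∘ suc) (c ∘ suc)) (dot (y ∘ suc) (c ∘ suc)))
  where
  rearrange : ∀ a b t p q → (a + - b) * t + (p + - q) ≡ (a * t + p) + - (b * t + q)
  rearrange = solve-∀

column : ∀ {d k} → (Fin d → Fin k → Bool) → Fin k → Fin d → Bool
column M j i = M i j

-- Combination of the Plücker relations of all rows, with coefficients x.
plücker-dot : ∀ {d} (N : Fin d → Fin (suc d) → Bool) (x : Fin d → ℤ) →
  altSum (λ j → dot x (column N j) * det (toℤMat (minor N j))) ≡ 0ℤ
plücker-dot N x = begin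
  altSum (λ j → dot x (column N j) * D j)
    ≡⟨ sumℤ-cong (λ j → trans
         (move (sign j) (dot x (column N j)) (D j))
         (sym (sumℤ-*ˡ (sign j * D j) (λ i → x i * toℤ (N i j))))) ⟩
  sumℤ (λ j → sumℤ (λ i → sign j * D j * (x i * toℤ (N i j))))
    ≡⟨ sumℤ-swap (λ j i → sign j * D j * (x i * toℤ (N i j))) ⟩
  sumℤ (λ i → sumℤ (λ j → sign j * D j * (x i * toℤ (N i j))))
    ≡⟨ sumℤ-cong (λ i → trans
         (sumℤ-cong (λ j → move′ (sign j) (D j) (x i) (toℤ (N i j))))
         (sumℤ-*ˡ (x i) (λ j → sign j * (toℤ (N i j) * D j)))) ⟩
  sumℤ (λ i → x i * altSum (λ j → toℤ (N i j) * D j))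
    ≡⟨ sumℤ-zero (λ i → x i * altSum (λ j → toℤ (N i j) * D j)) (λ i → trans
         (cong (x i *_) (plücker (λ r c → toℤ (N r c)) i))
         (*-zeroʳ (x i))) ⟩
  0ℤ ∎
  where
  D = λ j → det (toℤMat (minor N j))
  sign = λ j → (- + 1) ^ toℕ j
  move : ∀ s a b → s * (a * b) ≡ s * b * a
  move = solve-∀
  move′ : ∀ s a x t → s * a * (x * t) ≡ x * (s * (t * a))
  move′ = solve-∀

bordered : ∀ {d} → (Fin d → Bool) → (Fin d → Fin d → Bool) → Fin d → Fin (suc d) → Bool
bordered b M i zero    = b i
bordered b M i (suc j) = M i j

-- The matrix of Cramer's rule up to the order of columns: `b` stands in front instead of in
-- position `j`. The resulting sign is accounted for by `altSum`.
replace : ∀ {d} → (Fin d → Bool) → (Fin d → Fin d → Bool) → Fin d → Fin d → Fin d → Bool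
replace b M j = minor (bordered b M) (suc j)

-- This is the Plücker relation of `bordered b M`, with the term of column 0 separated: deleting `b`
-- leaves `M`, and deleting column `j` of `M` leaves `replace b M j`.
cramer : ∀ {d} b (M : Fin d → Fin d → Bool) (x : Fin d → ℤ) →
  det (toℤMat M) * dot x b ≡ altSum (λ j → dot x (column M j) * det (toℤMat (replace b M j)))
cramer b M x = i-j≡0⇒i≡j _ _ (begin
  det (toℤMat M) * dot x b + - rest       ≡⟨ rearrange (det (toℤMat M)) (dot x b) rest ⟩
  dot x b * det (toℤMat M) + - + 1 * rest ≡⟨ altSum-suc (λ j → dot x (column (bordered b M) j)
                                               * det (toℤMat (minor (bordered b M) j))) ⟨
  altSum (λ j → dot x (column (bordered b M) j) * det (toℤMat (minor (bordered b M) j)))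
                                          ≡⟨ plücker-dot (bordered b M) x ⟩
  0ℤ                                      ∎)
  where
  rest = altSum (λ j → dot x (column M j) * det (toℤMat (replace b M j)))
  rearrange : ∀ a b c → a * b + - c ≡ b * a + - + 1 * c
  rearrange = solve-∀

-- Divisibility by the modulus

∣-sumℤ : ∀ {k n} (f : Fin k → ℤ) → (∀ i → n ∣ f i) → n ∣ sumℤ f
∣-sumℤ {zero}  f n∣f = divides 0ℤ refl
∣-sumℤ {suc k} f n∣f = ∣m∣n⇒∣m+n (n∣f zero) (∣-sumℤ (f ∘ suc) (n∣f ∘ suc))

coprime-∣ : ∀ {n} i j → Coprime n ∣ i ∣ → + n ∣ i * j → + n ∣ j
coprime-∣ {n} i j cop n∣ij =
  ∣ᵤ⇒∣ (coprime-divisor cop (subst (n ℕ.∣_) (abs-* i j) (∣⇒∣ᵤ n∣ij)))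

-- Every term of the Cramer sum is divisible by `n`, through one factor or the other, and `det M`
-- can be cancelled because it is coprime to `n`. This serves both for implied equations and, with
-- `b` a unit vector, for injectivity.
∣-dot : ∀ {d n} b (M : Fin d → Fin d → Bool) (x : Fin d → ℤ) → Coprime n ∣ det (toℤMat M) ∣ →
  (∀ j → + n ∣ dot x (column M j) ⊎ det (toℤMat (replace b M j)) ≡ 0ℤ) → + n ∣ dot x b
∣-dot {n = n} b M x cop h = coprime-∣ (det (toℤMat M)) (dot x b) cop
  (subst (+ n ∣_) (sym (cramer b M x)) (∣-sumℤ _ (λ j → ∣n⇒∣m*n ((- + 1) ^ toℕ j) (term j (h j)))))
  where
  D = λ j → det (toℤMat (replace b M j))
  term : ∀ j → + n ∣ dot x (column M j) ⊎ D j ≡ 0ℤ → + n ∣ dot x (column M j) * D j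
  term j (inj₁ n∣x) = ∣m⇒∣m*n (D j) n∣x
  term j (inj₂ D≡0) = ∣n⇒∣m*n (dot x (column M j)) (divides 0ℤ D≡0)

residue≡0⇒∣ : ∀ i n .{{_ : NonZero n}} → i %ℕ n ≡ 0 → + n ∣ i
residue≡0⇒∣ i n eq = divides (i /ℕ n) (trans (a≡a%ℕn+[a/ℕn]*n i n)
  (trans (cong (λ r → + r + i /ℕ n * + n) eq) (+-identityˡ (i /ℕ n * + n))))

∣∧<⇒≡0 : ∀ {m n} → n ℕ.∣ m → m < n → m ≡ 0
∣∧<⇒≡0 {zero}  n∣m m<n = refl
∣∧<⇒≡0 {suc m} n∣m m<n = contradiction (ℕ.∣⇒≤ n∣m) (ℕ.<⇒≱ m<n)

∣⇒residue≡0 : ∀ i n .{{_ : NonZero n}} → + n ∣ i → i %ℕ n ≡ 0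
∣⇒residue≡0 i n n∣i = ∣∧<⇒≡0
  (∣⇒∣ᵤ (∣m+n∣n⇒∣m {m = + (i %ℕ n)} {i /ℕ n * + n}
    (subst (+ n ∣_) (a≡a%ℕn+[a/ℕn]*n i n) n∣i) (divides (i /ℕ n) refl)))
  (n%ℕd<d i n)

residue≡⇒∣- : ∀ i j n .{{_ : NonZero n}} → i %ℕ n ≡ j %ℕ n → + n ∣ i + - j
residue≡⇒∣- i j n eq = divides (i /ℕ n + - (j /ℕ n)) (begin
  i + - j                                       ≡⟨ cong₂ (λ a b → a + - b) (a≡a%ℕn+[a/ℕn]*n i n) (a≡a%ℕn+[a/ℕn]*n j n) ⟩
  (+ (i %ℕ n) + p * + n) + - (+ (j %ℕ n) + q * + n) ≡⟨ cong (λ r → (+ r + p * + n) + - (+ (j %ℕ n) + q * + n)) eq ⟩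
  (+ (j %ℕ n) + p * + n) + - (+ (j %ℕ n) + q * + n) ≡⟨ cancel (+ (j %ℕ n)) p q (+ n) ⟩
  (p + - q) * + n                               ∎)
  where
  p = i /ℕ n
  q = j /ℕ n
  cancel : ∀ r p q m → (r + p * m) + - (r + q * m) ≡ (p + - q) * m
  cancel = solve-∀

-- Both representatives lie below `n`, so their difference has absolute value below `n` and
-- divisibility forces it to be 0.
∣-⇒≡ : ∀ {n} (a b : Fin n) → + n ∣ + toℕ a + - + toℕ b → a ≡ b
∣-⇒≡ {n} a b n∣a-b = Fin.toℕ-injective (+-injective (i-j≡0⇒i≡j (+ toℕ a) (+ toℕ b)
  (∣i∣≡0⇒i≡0 (∣∧<⇒≡0 (∣⇒∣ᵤ n∣a-b) (ℕ.≤-<-trans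
    (subst (λ i → ∣ i ∣ ≤ toℕ a ℕ.⊔ toℕ b) (sym (m-n≡m⊖n (toℕ a) (toℕ b))) (∣m⊝n∣≤m⊔n (toℕ a) (toℕ b)))
    (ℕ.⊔-lub (Fin.toℕ<n a) (Fin.toℕ<n b)))))))

-- The transpose of a 0/1 matrix acting on residue vectors

coords : ∀ {n d} → Vec (Fin n) d → Fin d → ℤ
coords v i = + toℕ (lookup v i)

Vanishes : ∀ {n d} → (Fin d → Bool) → Vec (Fin n) d → Set
Vanishes {n} c v = + n ∣ dot (coords v) c

vanishes? : ∀ {n d} (c : Fin d → Bool) → Decidable (Vanishes {n} c)
vanishes? {n} c v = + n ∣? dot (coords v) c

residues : ∀ {n} .{{_ : NonZero n}} {d} → (Fin d → Fin d → Bool) → Vec (Fin n) d → Vec (Fin n) d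
residues {n} M v = tabulate (λ j → fromℕ< (n%ℕd<d (dot (coords v) (column M j)) n))

toℕ-residues : ∀ {n} .{{_ : NonZero n}} {d} (M : Fin d → Fin d → Bool) (v : Vec (Fin n) d) j →
  toℕ (lookup (residues M v) j) ≡ dot (coords v) (column M j) %ℕ n
toℕ-residues {n} M v j = trans
  (cong toℕ (lookup∘tabulate (λ j → fromℕ< (n%ℕd<d (dot (coords v) (column M j)) n)) j))
  (Fin.toℕ-fromℕ< (n%ℕd<d (dot (coords v) (column M j)) n))

-- The coordinate differences of `v` and `w` have dot products divisible by `n` with every column of
-- `M`. By `∣-dot` the same holds for every unit vector, that is, for each single coordinate
-- difference.
residues-injective : ∀ {n} .{{_ : NonZero n}} {d} (M : Fin d → Fin d → Bool) →
  Coprime n ∣ det (toℤMat M) ∣ →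
  ∀ (v w : Vec (Fin n) d) → residues M v ≡ residues M w → v ≡ w
residues-injective {n} M cop v w eq = begin
  v                   ≡⟨ tabulate∘lookup v ⟨
  tabulate (lookup v) ≡⟨ tabulate-cong coordinate≡ ⟩
  tabulate (lookup w) ≡⟨ tabulate∘lookup w ⟩
  w                   ∎
  where
  x = λ i → coords v i + - coords w i
  column∣ : ∀ j → + n ∣ dot x (column M j)
  column∣ j = subst (+ n ∣_) (sym (dot-minus (coords v) (coords w) (column M j)))
    (residue≡⇒∣- (dot (coords v) (column M j)) (dot (coords w) (column M j)) n (begin
      dot (coords v) (column M j) %ℕ n  ≡⟨ toℕ-residues M v j ⟨
      toℕ (lookup (residues M v) j)     ≡⟨ cong (λ u → toℕ (lookup u j)) eq ⟩
      toℕ (lookup (residues M w) j)     ≡⟨ toℕ-residues M w j ⟩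
      dot (coords w) (column M j) %ℕ n  ∎))
  coordinate≡ : ∀ i → lookup v i ≡ lookup w i
  coordinate≡ i = ∣-⇒≡ (lookup v i) (lookup w i) (subst (+ n ∣_) (dot-identity x i)
    (∣-dot (identity i) M x cop (λ j → inj₁ (column∣ j))))

-- Inclusion-exclusion over frames

-- No modulus occurs in a frame: nonsingularity is over the integers, so one frame serves every
-- admissible `n`. This makes the final polynomial independent of `n`.
record Frame (d : ℕ) : Set where
  field
    matrix      : Fin d → Fin d → Bool
    used        : Fin d → Bool
    nonsingular : det (toℤMat matrix) ≢ 0ℤ

open Frame

InFrame : ∀ {n d} → Frame d → Vec (Fin n) d → Set
InFrame F v = ∀ j → used F j ≡ true → Vanishes (column (matrix F) j) v

inFrame? : ∀ {n d} (F : Frame d) → Decidable (InFrame {n} F)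
inFrame? F v = Fin.all? (λ j → (used F j Bool.≟ true) →-dec vanishes? (column (matrix F) j) v)

CoprimeToDets : ℕ → ℕ → Set
CoprimeToDets d n = (M : Fin d → Fin d → Bool) → det (toℤMat M) ≢ + 0 → Coprime n ∣ det (toℤMat M) ∣

count-inFrame : ∀ {n} .{{_ : NonZero n}} {d} → CoprimeToDets d n → (F : Frame d) →
  count (inFrame? {n} F) ≡ n ℕ.^ unused (used F)
count-inFrame {n} cop F = begin
  count (inFrame? {n} F)
    ≡⟨ count-cong (inFrame? F) (zeroOn? (used F) ∘ residues (matrix F))
         (λ v h j u → trans (toℕ-residues (matrix F) v j) (∣⇒residue≡0 _ n (h j u)))
         (λ v h j u → residue≡0⇒∣ _ n (trans (sym (toℕ-residues (matrix F) v j)) (h j u))) ⟩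
  count (zeroOn? {n} (used F) ∘ residues (matrix F))
    ≡⟨ count-∘-injective (residues (matrix F))
         (residues-injective (matrix F) (cop (matrix F) (nonsingular F))) (zeroOn? (used F)) ⟩
  count (zeroOn? {n} (used F))
    ≡⟨ count-zeroOn (used F) ⟩
  n ℕ.^ unused (used F) ∎

-- By `cramer`, the coefficient of column `j` in the expansion of `b` is, up to sign,
-- `det (replace ...)` divided by `det M`. The condition says that no unmarked column occurs in it.
Spanned : ∀ {d} → Frame d → (Fin d → Bool) → Set
Spanned F b = ∀ j → used F j ≡ true ⊎ det (toℤMat (replace b (matrix F) j)) ≡ 0ℤ

spanned⇒vanishes : ∀ {n d} → CoprimeToDets d n → (F : Frame d) (b : Fin d → Bool) → Spanned F b →
  (v : Vec (Fin n) d) → InFrame F v → Vanishes b v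
spanned⇒vanishes {n} cop F b sp v h =
  ∣-dot b (matrix F) (coords v) (cop (matrix F) (nonsingular F)) (λ j → split j (sp j))
  where
  split : ∀ j → used F j ≡ true ⊎ det (toℤMat (replace b (matrix F) j)) ≡ 0ℤ →
    + n ∣ dot (coords v) (column (matrix F) j) ⊎ det (toℤMat (replace b (matrix F) j)) ≡ 0ℤ
  split j (inj₁ u)   = inj₁ (h j u)
  split j (inj₂ D≡0) = inj₂ D≡0

-- With nothing marked, all replacement determinants would be 0. The Plücker relation of a row `i`
-- in `S` would then reduce to `det M` being 0.
¬spanned-unused : ∀ {d} (F : Frame d) (S : Subset d) → (∀ j → used F j ≡ false) → Nonempty S →
  ¬ Spanned F (lookup S)
¬spanned-unused F S none (i , i∈S) sp = nonsingular F (begin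
  D                                 ≡⟨ rearrange D ⟩
  1ℤ * D + - + 1 * 0ℤ               ≡⟨ cong₂ (λ b t → toℤ b * D + - + 1 * t) ([]=⇒lookup i∈S) rest≡0 ⟨
  toℤ (lookup S i) * D + - + 1 * altSum rest
                                    ≡⟨ altSum-suc (λ j → toℤ (N i j) * det (toℤMat (minor N j))) ⟨
  altSum (λ j → toℤ (N i j) * det (toℤMat (minor N j)))
                                    ≡⟨ plücker (λ r c → toℤ (N r c)) i ⟩
  0ℤ                                ∎)
  where
  D = det (toℤMat (matrix F))
  N = bordered (lookup S) (matrix F)
  rest = λ j → toℤ (matrix F i j) * det (toℤMat (replace (lookup S) (matrix F) j))
  rearrange : ∀ x → x ≡ 1ℤ * x + - + 1 * 0ℤ
  rearrange = solve-∀
  minor≡0 : ∀ j → det (toℤMat (replace (lookup S) (matrix F) j)) ≡ 0ℤ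
  minor≡0 j with sp j
  ... | inj₁ u   = contradiction (trans (sym (none j)) u) (λ ())
  ... | inj₂ D≡0 = D≡0
  rest≡0 : altSum rest ≡ 0ℤ
  rest≡0 = sumℤ-zero _ (λ j → trans
    (cong (λ t → (- + 1) ^ toℕ j * (toℤ (matrix F i j) * t)) (minor≡0 j))
    (trans (cong ((- + 1) ^ toℕ j *_) (*-zeroʳ (toℤ (matrix F i j)))) (*-zeroʳ ((- + 1) ^ toℕ j))))

record Extension {d} (F : Frame d) (b : Fin d → Bool) : Set where
  field
    frame    : Frame d
    someUsed : ∃ λ j → used frame j ≡ true
    to       : ∀ {n} (v : Vec (Fin n) d) → InFrame F v × Vanishes b v → InFrame frame v
    from     : ∀ {n} (v : Vec (Fin n) d) → InFrame frame v → InFrame F v × Vanishes b v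

-- Only the unmarked column `j` is dropped from the bordered array, so no old equation is lost, and
-- `b` becomes a marked column. The marks are pulled back along `punchIn (suc j)`.
exchange : ∀ {d} (F : Frame d) (b : Fin d → Bool) j → used F j ≡ false →
  det (toℤMat (replace b (matrix F) j)) ≢ 0ℤ → Extension F b
exchange {suc d} F b j unused-j D≢0 = record
  { frame    = record
    { matrix      = replace b (matrix F) j
    ; used        = λ c → used⁺ (punchIn (suc j) c)
    ; nonsingular = D≢0 }
  -- `punchIn (suc j)` fixes `zero`, the position of `b`.
  ; someUsed = zero , refl
  ; to       = λ v h c → combine v h (punchIn (suc j) c)
  ; from     = λ v h → (λ c → restrict v h (suc c)) , restrict v h zero refl
  }
  where
  N = bordered b (matrix F)
  used⁺ : Fin (suc (suc d)) → Bool
  used⁺ zero    = true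
  used⁺ (suc c) = used F c
  combine : ∀ {n} (v : Vec (Fin n) (suc d)) → InFrame F v × Vanishes b v →
    ∀ c → used⁺ c ≡ true → Vanishes (column N c) v
  combine v (h , b≡0) zero    u = b≡0
  combine v (h , b≡0) (suc c) u = h c u
  restrict : ∀ {n} (v : Vec (Fin n) (suc d)) →
    (∀ c → used⁺ (punchIn (suc j) c) ≡ true → Vanishes (column N (punchIn (suc j) c)) v) →
    ∀ c → used⁺ c ≡ true → Vanishes (column N c) v
  -- A marked `c` differs from the dropped column `suc j`, so it is in the image of
  -- `punchIn (suc j)`.
  restrict v h c u = subst P (Fin.punchIn-punchOut j≢c)
    (h (punchOut j≢c)) u
    where
    P = λ c → used⁺ c ≡ true → Vanishes (column N c) v
    j≢c : suc j ≢ c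
    j≢c refl = contradiction (trans (sym unused-j) u) (λ ())

extend : ∀ {d} (F : Frame d) (b : Fin d → Bool) → Extension F b ⊎ Spanned F b
extend F b with Fin.any? (λ j → (used F j Bool.≟ false) ×-dec
                                ¬? (det (toℤMat (replace b (matrix F) j)) ≟ 0ℤ))
... | yes (j , unused-j , D≢0) = inj₁ (exchange F b j unused-j D≢0)
... | no none = inj₂ spanned
  where
  spanned : Spanned F b
  spanned j with used F j in u | det (toℤMat (replace b (matrix F) j)) ≟ 0ℤ
  ... | true  | _       = inj₁ refl
  ... | false | yes D≡0 = inj₂ D≡0
  ... | false | no  D≢0 = contradiction (j , u , D≢0) none

-- Solutions of a frame that avoid a list of hyperplanes

Avoids : ∀ {n d} → List (Subset d) → Vec (Fin n) d → Set
Avoids L v = All (λ S → ¬ Vanishes (lookup S) v) L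

avoids? : ∀ {n d} (L : List (Subset d)) → Decidable (Avoids {n} L)
avoids? L v = All.all? (λ S → ¬? (vanishes? (lookup S) v)) L

frameCount : ∀ n {d} → Frame d → List (Subset d) → ℕ
frameCount n F L = count {n} (λ v → inFrame? F v ×-dec avoids? L v)

frameCount-[] : ∀ {n} .{{_ : NonZero n}} {d} → CoprimeToDets d n → (F : Frame d) →
  frameCount n F [] ≡ n ℕ.^ unused (used F)
frameCount-[] cop F = trans
  (count-cong (λ v → inFrame? F v ×-dec avoids? [] v) (inFrame? F) (λ v → proj₁) (λ v h → h , []))
  (count-inFrame cop F)

-- The equation of `S` already holds on every solution of `F`, so no solution can avoid it.
frameCount-spanned : ∀ {n d} → CoprimeToDets d n → ∀ (F : Frame d) S L → Spanned F (lookup S) →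
  frameCount n F (S ∷ L) ≡ 0
frameCount-spanned cop F S L sp = count-none (λ v → inFrame? F v ×-dec avoids? (S ∷ L) v)
  (λ { v (h , S≢0 ∷ _) → S≢0 (spanned⇒vanishes cop F (lookup S) sp v h) })

-- One step of inclusion-exclusion: a solution avoiding `L` either satisfies the equation of `S`,
-- and so solves the extended frame, or avoids `S` as well.
frameCount-extension : ∀ {n d} (F : Frame d) S L (E : Extension F (lookup S)) →
  frameCount n F L ≡ frameCount n (Extension.frame E) L ℕ.+ frameCount n F (S ∷ L)
frameCount-extension {n} F S L E = trans
  (count-split (λ v → inFrame? F v ×-dec avoids? L v) (vanishes? (lookup S)))
  (cong₂ ℕ._+_
    (count-cong {n} (λ v → (inFrame? F v ×-dec avoids? L v) ×-dec vanishes? (lookup S) v)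
      (λ v → inFrame? (Extension.frame E) v ×-dec avoids? L v)
      (λ { v ((h , a) , z) → Extension.to E v (h , z) , a })
      (λ { v (h , a) → (proj₁ (Extension.from E v h) , a) , proj₂ (Extension.from E v h) }))
    (count-cong {n} (λ v → (inFrame? F v ×-dec avoids? L v) ×-dec ¬? (vanishes? (lookup S) v))
      (λ v → inFrame? F v ×-dec avoids? (S ∷ L) v)
      (λ { v ((h , a) , ¬z) → h , ¬z ∷ a })
      (λ { v (h , ¬z ∷ a) → (h , a) , ¬z })))

-- Polynomials of degree below d

evalPoly : ∀ {d} → (Fin d → ℤ) → ℤ → ℤ
evalPoly a x = sumℤ (λ i → a i * x ^ toℕ i)

evalPoly-minus : ∀ {d} (a b : Fin d → ℤ) x →
  evalPoly (λ i → a i + - b i) x ≡ evalPoly a x + - evalPoly b x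
evalPoly-minus a b x = begin
  sumℤ (λ i → (a i + - b i) * x ^ toℕ i)
    ≡⟨ sumℤ-cong (λ i → distrib (a i) (b i) (x ^ toℕ i)) ⟩
  sumℤ (λ i → a i * x ^ toℕ i + - + 1 * (b i * x ^ toℕ i))
    ≡⟨ sumℤ-+ (λ i → a i * x ^ toℕ i) (λ i → - + 1 * (b i * x ^ toℕ i)) ⟩
  evalPoly a x + sumℤ (λ i → - + 1 * (b i * x ^ toℕ i))
    ≡⟨ cong (λ t → evalPoly a x + t) (trans (sumℤ-*ˡ (- + 1) (λ i → b i * x ^ toℕ i)) (-1*i≡-i (evalPoly b x))) ⟩
  evalPoly a x + - evalPoly b x ∎
  where
  distrib : ∀ a b t → (a + - b) * t ≡ a * t + - + 1 * (b * t)
  distrib = solve-∀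

evalPoly-zero : ∀ {d} x → evalPoly {d} (λ _ → 0ℤ) x ≡ 0ℤ
evalPoly-zero {d} x = sumℤ-zero {d} (λ i → 0ℤ * x ^ toℕ i) (λ i → *-zeroˡ (x ^ toℕ i))

evalPoly-monomial : ∀ {d} (p : Fin d) x → evalPoly (toℤ ∘ identity p) x ≡ x ^ toℕ p
evalPoly-monomial p x = trans
  (sumℤ-cong (λ i → *-comm (toℤ (identity p i)) (x ^ toℕ i)))
  (dot-identity (λ i → x ^ toℕ i) p)

pos-^ : ∀ m k → + (m ℕ.^ k) ≡ (+ m) ^ k
pos-^ m zero    = refl
pos-^ m (suc k) = trans (pos-* m (m ℕ.^ k)) (cong (+ m *_) (pos-^ m k))

pos-difference : ∀ {a b c} → a ≡ b ℕ.+ c → + c ≡ + a + - + b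
pos-difference {a} {b} {c} refl = trans (cancel (+ b) (+ c)) (cong (_+ - + b) (sym (pos-+ b c)))
  where
  cancel : ∀ x y → y ≡ (x + y) + - x
  cancel = solve-∀

-- Induction on `L`: both frames in the recurrence have a marked column, so every power of `n`
-- reached at an empty list has exponent below `d`. The coefficients are fixed before `n` is given.
frameCount-poly : ∀ {d} (F : Frame d) → (∃ λ j → used F j ≡ true) → ∀ L →
  ∃ λ (a : Fin d → ℤ) → ∀ n .{{_ : NonZero n}} → CoprimeToDets d n →
    + frameCount n F L ≡ evalPoly a (+ n)
-- The count is the single power of `n` with exponent `p`, so its coefficient vector is the unit
-- vector at `p`.
frameCount-poly {d} F (j , u) [] = toℤ ∘ identity p , λ n cop → begin
  + frameCount n F []              ≡⟨ cong +_ (frameCount-[] cop F) ⟩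
  + (n ℕ.^ unused (used F))        ≡⟨ pos-^ n (unused (used F)) ⟩
  (+ n) ^ unused (used F)          ≡⟨ cong ((+ n) ^_) (Fin.toℕ-fromℕ< unused<d) ⟨
  (+ n) ^ toℕ p                    ≡⟨ evalPoly-monomial p (+ n) ⟨
  evalPoly (toℤ ∘ identity p) (+ n) ∎
  where
  unused<d = unused< (used F) j u
  p = fromℕ< unused<d
frameCount-poly {d} F u (S ∷ L) with extend F (lookup S)
... | inj₂ sp = (λ _ → 0ℤ) , λ n cop →
        trans (cong +_ (frameCount-spanned cop F S L sp)) (sym (evalPoly-zero {d} (+ n)))
... | inj₁ E =
  let a , a-eq = frameCount-poly F u L
      b , b-eq = frameCount-poly (Extension.frame E) (Extension.someUsed E) L
  in (λ i → a i + - b i) , λ n cop → begin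
    + frameCount n F (S ∷ L)
      ≡⟨ pos-difference (frameCount-extension F S L E) ⟩
    + frameCount n F L + - + frameCount n (Extension.frame E) L
      ≡⟨ cong₂ (λ s t → s + - t) (a-eq n cop) (b-eq n cop) ⟩
    evalPoly a (+ n) + - evalPoly b (+ n)
      ≡⟨ evalPoly-minus a b (+ n) ⟨
    evalPoly (λ i → a i + - b i) (+ n) ∎

-- Along the branch that keeps `F` the leading term persists down to the empty list, where all
-- `n ^ d` vectors are counted. Every subtracted count belongs to a frame with a marked column and
-- changes only lower coefficients.
frameCount-monic : ∀ {d} (F : Frame d) → (∀ j → used F j ≡ false) → ∀ L → All Nonempty L →
  ∃ λ (a : Fin d → ℤ) → ∀ n .{{_ : NonZero n}} → CoprimeToDets d n →
    + frameCount n F L ≡ (+ n) ^ d + evalPoly a (+ n)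
frameCount-monic {d} F none [] [] = (λ _ → 0ℤ) , λ n cop → begin
  + frameCount n F []                         ≡⟨ cong +_ (frameCount-[] cop F) ⟩
  + (n ℕ.^ unused (used F))                   ≡⟨ cong (λ k → + (n ℕ.^ k)) (unused≡ (used F) none) ⟩
  + (n ℕ.^ d)                                 ≡⟨ pos-^ n d ⟩
  (+ n) ^ d                                   ≡⟨ +-identityʳ ((+ n) ^ d) ⟨
  (+ n) ^ d + 0ℤ                              ≡⟨ cong (λ t → (+ n) ^ d + t) (evalPoly-zero {d} (+ n)) ⟨
  (+ n) ^ d + evalPoly {d} (λ _ → 0ℤ) (+ n)   ∎
frameCount-monic {d} F none (S ∷ L) (S≢∅ ∷ L≢∅) with extend F (lookup S)
-- Here the count would be 0 and the leading term lost; nonemptiness of `S` excludes this.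
... | inj₂ sp = contradiction sp (¬spanned-unused F S none S≢∅)
... | inj₁ E =
  let a , a-eq = frameCount-monic F none L L≢∅
      b , b-eq = frameCount-poly (Extension.frame E) (Extension.someUsed E) L
  in (λ i → a i + - b i) , λ n cop → begin
    + frameCount n F (S ∷ L)
      ≡⟨ pos-difference (frameCount-extension F S L E) ⟩
    + frameCount n F L + - + frameCount n (Extension.frame E) L
      ≡⟨ cong₂ (λ s t → s + - t) (a-eq n cop) (b-eq n cop) ⟩
    (+ n) ^ d + evalPoly a (+ n) + - evalPoly b (+ n)
      ≡⟨ +-assoc ((+ n) ^ d) (evalPoly a (+ n)) (- evalPoly b (+ n)) ⟩
    (+ n) ^ d + (evalPoly a (+ n) + - evalPoly b (+ n))
      ≡⟨ cong (λ t → (+ n) ^ d + t) (evalPoly-minus a b (+ n)) ⟨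
    (+ n) ^ d + evalPoly (λ i → a i + - b i) (+ n) ∎

-- From zero-sum-free vectors to frame counts

allSubsets : ∀ d → List (Subset d)
allSubsets zero    = [] ∷ []
allSubsets (suc d) = map (true ∷_) (allSubsets d) ++ map (false ∷_) (allSubsets d)

∈-allSubsets : ∀ {d} (S : Subset d) → S ∈ allSubsets d
∈-allSubsets []                  = here refl
∈-allSubsets (true ∷ S)          = ∈-++⁺ˡ (∈-map⁺ (true ∷_) (∈-allSubsets S))
∈-allSubsets {suc d} (false ∷ S) =
  ∈-++⁺ʳ (map (true ∷_) (allSubsets d)) (∈-map⁺ (false ∷_) (∈-allSubsets S))

nonemptySubsets : ∀ d → List (Subset d)
nonemptySubsets d = filter nonempty? (allSubsets d)

subsetSum≡dot : ∀ {n d} (v : Vec (Fin n) d) (S : Subset d) → + subsetSum v S ≡ dot (coords v) (lookup S)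
subsetSum≡dot []      []      = refl
subsetSum≡dot (x ∷ v) (b ∷ S) = trans
  (pos-+ (if b then toℕ x else 0) (subsetSum v S))
  (cong₂ _+_ (term b) (subsetSum≡dot v S))
  where
  term : ∀ b → + (if b then toℕ x else 0) ≡ + toℕ x * toℤ b
  term true  = sym (*-identityʳ (+ toℕ x))
  term false = sym (*-zeroʳ (+ toℕ x))

vanishes⇒%≡0 : ∀ {n} .{{_ : NonZero n}} {d} (v : Vec (Fin n) d) S →
  Vanishes (lookup S) v → subsetSum v S % n ≡ 0
vanishes⇒%≡0 {n} v S z = ∣⇒residue≡0 (+ subsetSum v S) n (subst (+ n ∣_) (sym (subsetSum≡dot v S)) z)

%≡0⇒vanishes : ∀ {n} .{{_ : NonZero n}} {d} (v : Vec (Fin n) d) S →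
  subsetSum v S % n ≡ 0 → Vanishes (lookup S) v
%≡0⇒vanishes {n} v S z = subst (+ n ∣_) (subsetSum≡dot v S) (residue≡0⇒∣ (+ subsetSum v S) n z)

-- The empty system of equations, solved by every vector; the identity matrix is only a nonsingular
-- starting point for exchanges.
standardFrame : ∀ d → Frame d
standardFrame d = record
  { matrix      = identity
  ; used        = λ _ → false
  ; nonsingular = λ det≡0 → contradiction (trans (sym (det-identity d)) det≡0) (λ ())
  }

α≡frameCount : ∀ n .{{_ : NonZero n}} d → α n d ≡ frameCount n (standardFrame d) (nonemptySubsets d)
α≡frameCount n d = trans
  (countVec≡sumVec d (λ v → ⌊ zeroSumFree? n v ⌋))
  (count-cong (zeroSumFree? n)
    (λ v → inFrame? (standardFrame d) v ×-dec avoids? (nonemptySubsets d) v)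
    -- With no marked columns the frame condition is vacuous, hence the absurd pattern.
    (λ v free → (λ j ()) , All.map
      (λ {S} S≢∅ z → free (S , S≢∅ , vanishes⇒%≡0 v S z)) (all-filter nonempty? (allSubsets d)))
    (λ { v (_ , avoids) (S , S≢∅ , eq) →
      All.lookup avoids (∈-filter⁺ nonempty? (∈-allSubsets S) S≢∅) (%≡0⇒vanishes v S eq) }))

theorem3p4 : (d : ℕ) → 1 ≤ d →
    ∃ λ (c : Vec ℤ d) →
    (n : ℕ) .{{_ : NonZero n}} →
    ((M : Fin d → Fin d → Bool) → det (toℤMat M) ≢ + 0 → Coprime n ∣ det (toℤMat M) ∣) →
    + α n d ≡ evalMonic c (+ n)
theorem3p4 d _ =
  let a , a-eq = frameCount-monic (standardFrame d) (λ _ → refl) (nonemptySubsets d)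
                   (all-filter nonempty? (allSubsets d))
  in tabulate a , λ n cop → begin
    + α n d                                   ≡⟨ cong +_ (α≡frameCount n d) ⟩
    + frameCount n (standardFrame d) (nonemptySubsets d) ≡⟨ a-eq n cop ⟩
    (+ n) ^ d + evalPoly a (+ n)
      ≡⟨ cong (λ t → (+ n) ^ d + t) (sumℤ-cong (λ i → cong (_* (+ n) ^ toℕ i) (lookup∘tabulate a i))) ⟨
    evalMonic (tabulate a) (+ n)              ∎
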